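{- Let $G$ be a finite, undirected, simple, connected graph. Then the following are equivalent: (i) $G\in\mathbf{l_2}/\mathbf{m_3}$; (ii) $G\in\mathbf{l_3}/\mathbf{m_3}$; (iii) $G\in\mathbf{SP}/\mathbf{m_3}$; (iv) $G$ is HHD-free. That is, $\mathbf{l_2}/\mathbf{m_3}=\mathbf{l_3}/\mathbf{m_3}=\mathbf{SP}/\mathbf{m_3}=\text{HHD-free}$.
   Context: All graphs are finite, undirected, simple and connected. A $uv$-walk is a sequence of (not necessarily distinct) vertices $W: u=v_0,v_1,\ldots,v_n=v$ with $v_{i-1}$ adjacent to $v_i$ for all $i\in\{1,\ldots,n\}$; $v_1,\ldots,v_{n-1}$ are its internal vertices and $n$ is its length. A $uv$-path is a $uv$-walk with distinct vertices. A $uv$-induced path is a $uv$-path in which two vertices are adjacent in $G$ if and only if they are consecutive on the path. For non-adjacent vertices $u,v$: - $\mathbf{m_3}(u,v)$ is the set of $uv$-$m_3$ paths, i.e. $uv$-induced paths of length at least three. - $\mathbf{l_k}(u,v)$ is the set of $uv$-$l_k$-paths, i.e. $uv$-induced paths of length at most $k$. - $\mathbf{SP}(u,v)$ is the set of $uv$-shortest paths, i.e. $uv$-paths of length equal to the distance $d(u,v)$ in $G$. Domination: for non-adjacent $u,v$, a $uv$-walk $W$ dominates a $uv$-walk $W'$ if every internal vertex of $W'$ is adjacent to some internal vertex of $W$ or belongs to $W$. The class $\mathbf{A}/\mathbf{B}$ consists of all graphs $G$ such that for every pair of non-adjacent vertices $u,v$ of $G$, every walk $W\in\mathbf{A}(u,v)$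 dominates every walk $W'\in\mathbf{B}(u,v)$ (vacuously true if one of the sets is empty). A hole is a chordless cycle with at least five vertices. A house is the complement of an induced path with five vertices. A domino is the graph obtained from the chordless cycle $x_0,x_1,\ldots,x_5$ by adding the chord $x_1x_4$. A graph is HHD-free if it contains no house, no hole and no domino as an induced subgraph. -}

module Defs where

open import Level using (0ℓ)
open import Data.Nat using (ℕ; zero; suc; _≤_; _<_)
import Data.Nat.Properties as ℕ
open import Data.Fin using (Fin; zero; suc; toℕ; fromℕ; inject₁; #_)
import Data.Fin.Properties as Fin
open import Data.Product using (∃-syntax; _×_; _,_)
open import Data.Sum using (_⊎_; swap)
open import Function.Base using (_∘_)
open import Function.Bundles using (_⇔_)
open import Function.Definitions using (Injective)
open import Relation.Binary.Core using (Rel)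
open import Relation.Binary.Definitions using (Decidable; Symmetric; Irreflexive)
open import Relation.Binary.PropositionalEquality using (_≡_; _≢_; sym)
open import Relation.Nullary using (¬_)
open import Relation.Nullary.Decidable using (_×-dec_; _⊎-dec_; ¬?)

record Graph : Set₁ where
  field
    order  : ℕ
    Adj    : Rel (Fin order) 0ℓ
    adj?   : Decidable Adj
    symm   : Symmetric Adj
    irrefl : Irreflexive _≡_ Adj

  Vertex : Set
  Vertex = Fin order

open Graph using (Vertex; Adj)

module _ (G : Graph) where

  record Walk (u v : Vertex G) : Set where
    field
      length : ℕ
      vertex : Fin (suc length) → Vertex G
      start  : vertex zero ≡ u
      end    : vertex (fromℕ length) ≡ v
      step   : (i : Fin length) → Adj G (vertex (inject₁ i)) (vertex (suc i))

  Connected : Set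
  Connected = ∀ u v → Walk u v

open Walk using (length; vertex)

Consecutive : ∀ {n} → Rel (Fin n) 0ℓ
Consecutive i j = toℕ j ≡ suc (toℕ i) ⊎ toℕ i ≡ suc (toℕ j)

module _ {G : Graph} {u v : Vertex G} where

  _∈_ : Vertex G → Walk G u v → Set
  x ∈ W = ∃[ i ] vertex W i ≡ x

  -- A vertex is internal when it occurs at some position strictly between the
  -- two ends of the sequence.
  _∈°_ : Vertex G → Walk G u v → Set
  x ∈° W = ∃[ i ] (0 < toℕ i × toℕ i < length W × vertex W i ≡ x)

  IsPath : Walk G u v → Set
  IsPath W = Injective _≡_ _≡_ (vertex W)

  IsInducedPath : Walk G u v → Set
  IsInducedPath W =
    IsPath W × (∀ i j → Adj G (vertex W i) (vertex W j) ⇔ Consecutive i j)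

  _Dominates_ : Walk G u v → Walk G u v → Set
  W Dominates W′ = ∀ x → x ∈° W′ → (∃[ y ] (y ∈° W × Adj G x y)) ⊎ x ∈ W

-- Minimising over all walks or over paths only gives the same number.
IsDistance : (G : Graph) → Vertex G → Vertex G → ℕ → Set
IsDistance G u v d =
  (∃[ W ] length {G} {u} {v} W ≡ d) × ((W : Walk G u v) → d ≤ length W)

WalkFamily : Set₁
WalkFamily = (G : Graph) {u v : Vertex G} → Walk G u v → Set

m₃ : WalkFamily
m₃ G W = IsInducedPath W × 3 ≤ length W

l : ℕ → WalkFamily
l k G W = IsInducedPath W × length W ≤ k

SP : WalkFamily
SP G {u} {v} W = IsPath W × IsDistance G u v (length W)

-- The case u ≡ v is not excluded, but it is vacuous when B consists of paths of
-- positive length.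
infix 6 _/_

_/_ : WalkFamily → WalkFamily → Graph → Set
(A / B) G = ∀ u v → ¬ Adj G u v →
  (W W′ : Walk G u v) → A G W → B G W′ → W Dominates W′

-- The simple graph whose edges are the pairs of distinct vertices related by R
-- in at least one direction.
fromRel : ∀ {n} (R : Rel (Fin n) 0ℓ) → Decidable R → Graph
fromRel {n} R R? = record
  { order  = n
  ; Adj    = λ i j → i ≢ j × (R i j ⊎ R j i)
  ; adj?   = λ i j → ¬? (i Fin.≟ j) ×-dec (R? i j ⊎-dec R? j i)
  ; symm   = λ (i≢j , r) → (i≢j ∘ sym) , swap r
  ; irrefl = λ i≡j (i≢j , _) → i≢j i≡j
  }

complement : Graph → Graph
complement G = fromRel (λ i j → ¬ Adj G i j) (λ i j → ¬? (Graph.adj? G i j))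

addEdge : (G : Graph) → Vertex G → Vertex G → Graph
addEdge G a b = fromRel
  (λ i j → Adj G i j ⊎ (i ≡ a × j ≡ b))
  (λ i j → Graph.adj? G i j ⊎-dec ((i Fin.≟ a) ×-dec (j Fin.≟ b)))

path : ℕ → Graph
path n = fromRel {n}
  (λ i j → toℕ j ≡ suc (toℕ i))
  (λ i j → toℕ j ℕ.≟ suc (toℕ i))

-- Only a cycle for n ≥ 3.
cycle : ℕ → Graph
cycle n = fromRel {n}
  (λ i j → toℕ j ≡ suc (toℕ i) ⊎ (suc (toℕ i) ≡ n × toℕ j ≡ 0))
  (λ i j → (toℕ j ℕ.≟ suc (toℕ i))
             ⊎-dec ((suc (toℕ i) ℕ.≟ n) ×-dec (toℕ j ℕ.≟ 0)))

house : Graph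
house = complement (path 5)

domino : Graph
domino = addEdge (cycle 6) (# 1) (# 4)

_InducedIn_ : Graph → Graph → Set
H InducedIn G = ∃[ f ]
  (Injective _≡_ _≡_ f × (∀ (i j : Vertex H) → Adj H i j ⇔ Adj G (f i) (f j)))

HHDFree : Graph → Set
HHDFree G =
    ¬ (house InducedIn G)
  × (∀ n → 5 ≤ n → ¬ (cycle n InducedIn G))
  × ¬ (domino InducedIn G)

{-# OPTIONS --safe #-}
module Submission where

open import Data.Bool as Bool using (Bool; true; false)
open import Data.Empty using (⊥; ⊥-elim)
open import Data.Fin as Fin using (Fin; zero; suc; toℕ; fromℕ; fromℕ<; inject₁; #_)
open import Data.Fin.Properties as Fin using ()
open import Data.Nat
  using (ℕ; zero; suc; _+_; _∸_; _≤_; _<_; z≤n; s≤s; z<s; s<s; _≤?_; _<?_; _≟_)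
open import Data.Nat.Properties
open import Data.Product using (∃-syntax; _×_; _,_; proj₁; proj₂)
open import Data.Sum using (_⊎_; inj₁; inj₂; [_,_]′)
open import Data.Unit using (⊤; tt)
open import Data.Vec using (Vec; _∷_; []; lookup)
open import Function.Base using (_∘_; const; case_of_)
open import Function.Bundles using (_⇔_; mk⇔; Equivalence)
open import Function.Definitions using (Injective)
open import Relation.Binary.Definitions using (tri<; tri≈; tri>)
open import Relation.Binary.PropositionalEquality
  using (_≡_; _≢_; refl; sym; trans; cong; subst; subst₂)
open import Relation.Nullary using (¬_; Dec; yes; no; does; contradiction)
open import Relation.Nullary.Decidable
  using (_×-dec_; _⊎-dec_; _→-dec_; ¬?; map′; True; toWitness; from-yes; does-⇔)
open import Defs

-- Every family in the statement consists of induced paths, so the heart of the matter is that in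
-- an HHD-free graph every induced uv-path P dominates every uv-m₃ path Q = q₀ … qₙ.  Suppose an
-- internal x = qᵢ is undominated, and let S = s₀ … sₑ be the internal vertices of P.  Take the last
-- a before x and the first b after x on Q with a neighbour in S.  Closing the piece of Q between
-- them through a minimal piece of S gives an induced cycle, which is not a hole, so it is a square
-- a x b sₗ.  As n ≥ 3, after reversing both paths if necessary, b ≠ v.  Let f₀ be the last vertex
-- of S adjacent to both a and b, and follow S from f₀ towards v up to the first vertex which is
-- adjacent to a or to the piece of Q from b to v.  This yields an induced cycle sharing with the
-- square only the edge f₀a or f₀b: together they are a house or a domino, or the cycle is a hole.
--
-- Conversely, in a house, a hole or a domino two vertices at distance two are joined by a shortest
-- path and by a longer induced path that it does not dominate.

first : {P : ℕ → Set} → (∀ k → Dec (P k)) → ∀ {n} → P n →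
  ∃[ k ] (k ≤ n × P k × (∀ {i} → i < k → ¬ P i))
first P? {n} p with P? 0
... | yes p₀ = 0 , z≤n , p₀ , λ ()
first P? {zero}  p | no ¬p₀ = contradiction p ¬p₀
first P? {suc n} p | no ¬p₀ with first (P? ∘ suc) p
... | k , k≤n , pk , min = suc k , s≤s k≤n , pk ,
  λ { {zero} _ → ¬p₀ ; {suc i} (s≤s i<k) → min i<k }

last : {P : ℕ → Set} → (∀ k → Dec (P k)) → ∀ {m n} → m ≤ n → P m →
  ∃[ k ] (k ≤ n × P k × (∀ {i} → k < i → i ≤ n → ¬ P i))
last P? {n = n} m≤n p with P? n
... | yes pₙ = n , ≤-refl , pₙ , λ n<i i≤n → contradiction (<-≤-trans n<i i≤n) (<-irrefl refl)
... | no ¬pₙ with m≤n⇒m<n∨m≡n m≤n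
...   | inj₂ refl = contradiction p ¬pₙ
...   | inj₁ (s≤s m≤n′) with last P? m≤n′ p
...     | k , k≤n , pₖ , max = k , m≤n⇒m≤1+n k≤n , pₖ , λ k<i i≤n →
  [ (λ { (s≤s i≤n′) → max k<i i≤n′ }) , (λ { refl → ¬pₙ }) ]′ (m≤n⇒m<n∨m≡n i≤n)

some≤? : {P : ℕ → Set} → (∀ k → Dec (P k)) → ∀ n → Dec (∃[ k ] (k ≤ n × P k))
some≤? P? n = map′
  (λ { (k , s≤s k≤n , p) → k , k≤n , p })
  (λ { (k , k≤n , p) → k , s≤s k≤n , p })
  (anyUpTo? P? (suc n))

module _ (G : Graph) where
  open Graph G renaming (symm to ~-sym)

  infix 4 _~_
  _~_ : Vertex → Vertex → Set
  _~_ = Adj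

  -- Agrees, AgreesOn and Realizes compute the adjacencies to be checked for a small pattern graph
  -- as a nested product; only the pairs above the diagonal occur.
  Agrees : Bool → Set → Set
  Agrees true  A = A
  Agrees false A = ¬ A

  AgreesOn : ∀ {n} → (Fin n → Bool) → Vertex → Vec Vertex n → Set
  AgreesOn b x []       = ⊤
  AgreesOn b x (y ∷ ys) = Agrees (b zero) (x ~ y) × AgreesOn (b ∘ suc) x ys

  Realizes : ∀ {n} → (Fin n → Fin n → Bool) → Vec Vertex n → Set
  Realizes b []       = ⊤
  Realizes b (x ∷ xs) =
    AgreesOn (b zero ∘ suc) x xs × Realizes (λ i j → b (suc i) (suc j)) xs

  agreesOn-lookup : ∀ {n} {b : Fin n → Bool} {x} xs → AgreesOn b x xs →
    ∀ i → Agrees (b i) (x ~ lookup xs i)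
  agreesOn-lookup (y ∷ ys) (r , _)  zero    = r
  agreesOn-lookup (y ∷ ys) (_ , rs) (suc i) = agreesOn-lookup ys rs i

  realizes-lookup : ∀ {n} {b : Fin n → Fin n → Bool} xs → Realizes b xs →
    ∀ {i j} → i Fin.< j → Agrees (b i j) (lookup xs i ~ lookup xs j)
  realizes-lookup (x ∷ xs) (r , _)  {zero}  {suc j} _         = agreesOn-lookup xs r j
  realizes-lookup (x ∷ xs) (_ , rs) {suc i} {suc j} (s≤s i<j) = realizes-lookup xs rs i<j

  agrees⇒⇔ : ∀ {A B : Set} (A? : Dec A) → Agrees (does A?) B → A ⇔ B
  agrees⇒⇔ (yes a) b  = mk⇔ (λ _ → b) (λ _ → a)
  agrees⇒⇔ (no ¬a) ¬b = mk⇔ (λ a → contradiction a ¬a) (λ b → contradiction b ¬b)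

  module _ (H : Graph) where
    open Graph H using () renaming (Adj to _~ᴴ_)

    extend-⇔ : (f : Graph.Vertex H → Vertex) →
      (∀ {i j} → i Fin.< j → i ~ᴴ j ⇔ f i ~ f j) → ∀ i j → i ~ᴴ j ⇔ f i ~ f j
    extend-⇔ f pres i j with Fin.<-cmp i j
    ... | tri< i<j _ _ = pres i<j
    ... | tri≈ _ refl _ = mk⇔ (⊥-elim ∘ Graph.irrefl H refl) (⊥-elim ∘ irrefl refl)
    ... | tri> _ _ j<i = mk⇔ (~-sym ∘ to ∘ Graph.symm H) (Graph.symm H ∘ from ∘ ~-sym)
      where open Equivalence (pres j<i)

    -- In a twin-free H an adjacency-preserving and -reflecting map is automatically injective.
    TwinFree : Set
    TwinFree = ∀ i j → i ≡ j ⊎ ∃[ k ] does (Graph.adj? H i k) ≢ does (Graph.adj? H j k)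

    twinFree? : Dec TwinFree
    twinFree? = Fin.all? λ i → Fin.all? λ j → (i Fin.≟ j) ⊎-dec
      Fin.any? λ k → ¬? (does (Graph.adj? H i k) Bool.≟ does (Graph.adj? H j k))

    realize : TwinFree → (xs : Vec Vertex (Graph.order H)) →
      Realizes (λ i j → does (Graph.adj? H i j)) xs → H InducedIn G
    realize twinFree xs r = lookup xs , inj , pres
      where
      pres : ∀ i j → i ~ᴴ j ⇔ lookup xs i ~ lookup xs j
      pres = extend-⇔ (lookup xs) λ {i} {j} i<j →
        agrees⇒⇔ (Graph.adj? H i j) (realizes-lookup xs r i<j)
      inj : Injective _≡_ _≡_ (lookup xs)
      inj {i} {j} eq with twinFree i j
      ... | inj₁ i≡j = i≡j
      ... | inj₂ (k , differ) = contradiction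
        (does-⇔ (mk⇔ (from (pres j k) ∘ subst (_~ lookup xs k) eq ∘ to (pres i k))
                     (from (pres i k) ∘ subst (_~ lookup xs k) (sym eq) ∘ to (pres j k)))
          (Graph.adj? H i k) (Graph.adj? H j k)) differ
        where open Equivalence

  -- The vertices are f 0 , … , f n, so n is the length; the values of f beyond n are junk.
  record Induced (f : ℕ → Vertex) (n : ℕ) : Set where
    field
      edge      : ∀ {i} → i < n → f i ~ f (suc i)
      distinct  : ∀ {i j} → i < j → j ≤ n → f i ≢ f j
      chordless : ∀ {i j} → i < j → j ≤ n → f i ~ f j → j ≡ suc i

  open Induced

  take : ∀ {f m n} → m ≤ n → Induced f n → Induced f m
  take m≤n F .edge      i<m       = F .edge (≤-trans i<m m≤n)
  take m≤n F .distinct  i<j j≤m   = F .distinct i<j (≤-trans j≤m m≤n)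
  take m≤n F .chordless i<j j≤m e = F .chordless i<j (≤-trans j≤m m≤n) e

  drop : ∀ {f n} a → Induced f (n + a) → Induced (λ i → f (i + a)) n
  drop a F .edge      i<n       = F .edge (+-monoˡ-< a i<n)
  drop a F .distinct  i<j j≤n   = F .distinct (+-monoˡ-< a i<j) (+-monoˡ-≤ a j≤n)
  drop a F .chordless {i} {j} i<j j≤n e = +-cancelʳ-≡ a j (suc i)
    (F .chordless (+-monoˡ-< a i<j) (+-monoˡ-≤ a j≤n) e)

  dropTo : ∀ {f n a} → a ≤ n → Induced f n → Induced (λ i → f (i + a)) (n ∸ a)
  dropTo {f} {a = a} a≤n F = drop a (subst (Induced f) (sym (m∸n+n≡m a≤n)) F)

  tail : ∀ {f n} → Induced f (suc n) → Induced (f ∘ suc) n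
  tail F .edge      i<n       = F .edge (s<s i<n)
  tail F .distinct  i<j j≤n   = F .distinct (s<s i<j) (s≤s j≤n)
  tail F .chordless i<j j≤n e = suc-injective (F .chordless (s<s i<j) (s≤s j≤n) e)

  reverse : ∀ {f n} → Induced f n → Induced (λ i → f (n ∸ i)) n
  reverse {f} {n} F .edge {i} i<n = ~-sym (subst (λ k → f (n ∸ suc i) ~ f k)
    (sym (+-∸-assoc 1 i<n)) (F .edge (subst (_≤ n) (+-∸-assoc 1 i<n) (m∸n≤m n i))))
  reverse {f} {n} F .distinct {i} i<j j≤n eq =
    F .distinct (∸-monoʳ-< i<j j≤n) (m∸n≤m n i) (sym eq)
  reverse {f} {n} F .chordless {i} {j} i<j j≤n e =
    +-cancelʳ-≡ (n ∸ j) j (suc i) (begin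
      j + (n ∸ j)       ≡⟨ m+[n∸m]≡n j≤n ⟩
      n                 ≡⟨ sym (m+[n∸m]≡n (≤-trans (<⇒≤ i<j) j≤n)) ⟩
      i + (n ∸ i)       ≡⟨ cong (i +_) (F .chordless (∸-monoʳ-< i<j j≤n) (m∸n≤m n i) (~-sym e)) ⟩
      i + suc (n ∸ j)   ≡⟨ +-suc i (n ∸ j) ⟩
      suc i + (n ∸ j)   ∎)
    where open Relation.Binary.PropositionalEquality.≡-Reasoning

  singleton : ∀ x → Induced (const x) 0
  singleton x .edge      ()
  singleton x .distinct  (s≤s _) ()
  singleton x .chordless (s≤s _) ()

  -- The vertices are c 0 , … , c m, so the cycle has length suc m.
  record InducedCycle (c : ℕ → Vertex) (m : ℕ) : Set where
    field
      edge     : ∀ {i} → i < m → c i ~ c (suc i)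
      closing  : c 0 ~ c m
      distinct : ∀ {i j} → i < j → j ≤ m → c i ≢ c j
      chords   : ∀ {i j} → i < j → j ≤ m → c i ~ c j → j ≡ suc i ⊎ (i ≡ 0 × j ≡ m)

  -- f 0 , … , f m , g 0 , g 1 , …
  join : (ℕ → Vertex) → ℕ → (ℕ → Vertex) → ℕ → Vertex
  join f m       g zero    = f 0
  join f zero    g (suc k) = g k
  join f (suc m) g (suc k) = join (f ∘ suc) m g k

  join-left : ∀ f m g {k} → k ≤ m → join f m g k ≡ f k
  join-left f m       g z≤n       = refl
  join-left f (suc m) g (s≤s k≤m) = join-left (f ∘ suc) m g k≤m

  join-right : ∀ f m g k → join f m g (suc (m + k)) ≡ g k
  join-right f zero    g k = refl
  join-right f (suc m) g k = join-right (f ∘ suc) m g k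

  data Side (m n : ℕ) : ℕ → Set where
    left  : ∀ {k} → k ≤ m → Side m n k
    right : ∀ {k} → k ≤ n → Side m n (suc (m + k))

  side : ∀ m n {k} → k ≤ suc (m + n) → Side m n k
  side m n {k} k≤ with k ≤? m
  ... | yes k≤m = left k≤m
  ... | no k≰m with m≤n⇒∃[o]m+o≡n (≰⇒> k≰m)
  ...   | l , refl = right (+-cancelˡ-≤ (suc m) l n k≤)

  module Join {f g m n} (F : Induced f m) (H : Induced g n)
    (disjoint : ∀ {i j} → i ≤ m → j ≤ n → f i ≢ g j)
    (link  : f m ~ g 0) (link′ : f 0 ~ g n)
    (cross : ∀ {i j} → i ≤ m → j ≤ n → f i ~ g j → (i ≡ m × j ≡ 0) ⊎ (i ≡ 0 × j ≡ n))
    where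

    c : ℕ → Vertex
    c = join f m g

    c-left : ∀ {k} → k ≤ m → c k ≡ f k
    c-left = join-left f m g

    c-right : ∀ k → c (suc (m + k)) ≡ g k
    c-right = join-right f m g

    joined-cycle : InducedCycle c (suc (m + n))
    joined-cycle .InducedCycle.edge {i} i< with side m n (<⇒≤ i<)
    ... | right {k} k≤n = subst₂ _~_ (sym (c-right k))
      (trans (sym (c-right (suc k))) (cong (c ∘ suc) (+-suc m k)))
      (H .edge (+-cancelˡ-< (suc m) k n i<))
    ... | left i≤m with m≤n⇒m<n∨m≡n i≤m
    ...   | inj₁ i<m  = subst₂ _~_ (sym (c-left i≤m)) (sym (c-left i<m)) (F .edge i<m)
    ...   | inj₂ refl = subst₂ _~_ (sym (c-left ≤-refl))
      (trans (sym (c-right 0)) (cong (c ∘ suc) (+-identityʳ m))) link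
    joined-cycle .InducedCycle.closing = subst (f 0 ~_) (sym (c-right n)) link′
    joined-cycle .InducedCycle.distinct i<j j≤ eq with side m n (<⇒≤ (<-≤-trans i<j j≤)) | side m n j≤
    ... | left i≤m | left j≤m  = F .distinct i<j j≤m
      (trans (sym (c-left i≤m)) (trans eq (c-left j≤m)))
    ... | left i≤m | right {l} l≤n = disjoint i≤m l≤n
      (trans (sym (c-left i≤m)) (trans eq (c-right l)))
    ... | right {k} k≤n | left j≤m =
      m+n≮m m k (<⇒≤ (<-≤-trans i<j j≤m))
    ... | right {k} k≤n | right {l} l≤n =
      H .distinct (+-cancelˡ-< (suc m) k l i<j) l≤n (trans (sym (c-right k)) (trans eq (c-right l)))
    joined-cycle .InducedCycle.chords i<j j≤ e with side m n (<⇒≤ (<-≤-trans i<j j≤)) | side m n j≤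
    ... | left i≤m | left j≤m  = inj₁ (F .chordless i<j j≤m (subst₂ _~_ (c-left i≤m) (c-left j≤m) e))
    ... | left i≤m | right {l} l≤n with cross i≤m l≤n (subst₂ _~_ (c-left i≤m) (c-right l) e)
    ...   | inj₁ (refl , refl) = inj₁ (cong suc (+-identityʳ m))
    ...   | inj₂ (refl , refl) = inj₂ (refl , refl)
    joined-cycle .InducedCycle.chords i<j j≤ e | right {k} k≤n | left j≤m =
      contradiction (<⇒≤ (<-≤-trans i<j j≤m)) (m+n≮m m k)
    joined-cycle .InducedCycle.chords i<j j≤ e | right {k} k≤n | right {l} l≤n =
      inj₁ (cong suc (trans (cong (m +_)
        (H .chordless (+-cancelˡ-< (suc m) k l i<j) l≤n (subst₂ _~_ (c-right k) (c-right l) e)))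
        (+-suc m k)))

  hole : ∀ {c m} → InducedCycle c m → cycle (suc m) InducedIn G
  hole {c} {m} C = f , inj , extend-⇔ (cycle (suc m)) f λ i<j → mk⇔ (to i<j) (from i<j)
    where
    open InducedCycle C renaming (edge to c-edge; distinct to c-distinct)
    f : Fin (suc m) → Vertex
    f = c ∘ toℕ
    inj : Injective _≡_ _≡_ f
    inj {i} {j} eq with Fin.<-cmp i j
    ... | tri< i<j _ _ = contradiction eq (c-distinct i<j (Fin.toℕ≤pred[n] j))
    ... | tri≈ _ i≡j _ = i≡j
    ... | tri> _ _ j<i = contradiction (sym eq) (c-distinct j<i (Fin.toℕ≤pred[n] i))
    to : ∀ {i j} → i Fin.< j → Graph.Adj (cycle (suc m)) i j → f i ~ f j
    to {i} {j} i<j (_ , inj₁ (inj₁ j≡1+i)) =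
      subst (λ k → f i ~ c k) (sym j≡1+i)
        (c-edge (≤-trans (≤-reflexive (sym j≡1+i)) (Fin.toℕ≤pred[n] j)))
    to {i} {j} i<j (_ , inj₁ (inj₂ (_ , j≡0))) = contradiction (subst (toℕ i <_) j≡0 i<j) λ ()
    to {i} {j} i<j (_ , inj₂ (inj₁ i≡1+j)) =
      contradiction (≤-trans (n≤1+n _) (subst (_< toℕ j) i≡1+j i<j)) 1+n≰n
    to {i} {j} i<j (_ , inj₂ (inj₂ (1+j≡1+m , i≡0))) =
      subst₂ (λ k l → c k ~ c l) (sym i≡0) (sym (suc-injective 1+j≡1+m)) closing
    from : ∀ {i j} → i Fin.< j → f i ~ f j → Graph.Adj (cycle (suc m)) i j
    from {i} {j} i<j e = Fin.<⇒≢ i<j , (case chords i<j (Fin.toℕ≤pred[n] j) e of λ where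
      (inj₁ j≡1+i)       → inj₁ (inj₁ j≡1+i)
      (inj₂ (i≡0 , j≡m)) → inj₂ (inj₂ (cong suc j≡m , i≡0)))

  module _ (hhd : HHDFree G) where

    short : ∀ {c m} → InducedCycle c m → m < 4
    short {m = m} C with 4 ≤? m
    ... | yes 4≤m = ⊥-elim (hhd .proj₂ .proj₁ (suc m) (s≤s 4≤m) (hole C))
    ... | no  4≰m = ≰⇒> 4≰m

    no-house : ∀ {x₀ x₁ x₂ x₃ x₄} → x₀ ~ x₁ → x₁ ~ x₂ → x₂ ~ x₃ → x₃ ~ x₀ →
      ¬ x₀ ~ x₂ → ¬ x₁ ~ x₃ → x₄ ~ x₂ → x₄ ~ x₃ → ¬ x₄ ~ x₀ → ¬ x₄ ~ x₁ → ⊥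
    no-house {x₀} {x₁} {x₂} {x₃} {x₄} e₀₁ e₁₂ e₂₃ e₃₀ n₀₂ n₁₃ e₄₂ e₄₃ n₄₀ n₄₁ =
      hhd .proj₁ (realize house (from-yes (twinFree? house))
        (x₂ ∷ x₀ ∷ x₄ ∷ x₁ ∷ x₃ ∷ [])
        ( (n₀₂ ∘ ~-sym , ~-sym e₄₂ , ~-sym e₁₂ , e₂₃ , tt)
        , (n₄₀ ∘ ~-sym , e₀₁ , ~-sym e₃₀ , tt)
        , (n₄₁ , e₄₃ , tt) , (n₁₃ , tt) , tt , tt))

    no-domino : ∀ {x₀ x₁ x₂ x₃ x₄ x₅} →
      x₀ ~ x₁ → x₁ ~ x₂ → x₂ ~ x₃ → x₃ ~ x₄ → x₄ ~ x₅ → x₅ ~ x₀ → x₁ ~ x₄ →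
      ¬ x₀ ~ x₂ → ¬ x₀ ~ x₃ → ¬ x₀ ~ x₄ → ¬ x₁ ~ x₃ → ¬ x₁ ~ x₅ → ¬ x₂ ~ x₄ →
      ¬ x₂ ~ x₅ → ¬ x₃ ~ x₅ → ⊥
    no-domino {x₀} {x₁} {x₂} {x₃} {x₄} {x₅}
      e₀₁ e₁₂ e₂₃ e₃₄ e₄₅ e₅₀ e₁₄ n₀₂ n₀₃ n₀₄ n₁₃ n₁₅ n₂₄ n₂₅ n₃₅ =
      hhd .proj₂ .proj₂ (realize domino (from-yes (twinFree? domino))
        (x₀ ∷ x₁ ∷ x₂ ∷ x₃ ∷ x₄ ∷ x₅ ∷ [])
        ( (e₀₁ , n₀₂ , n₀₃ , n₀₄ , ~-sym e₅₀ , tt)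
        , (e₁₂ , n₁₃ , e₁₄ , n₁₅ , tt)
        , (e₂₃ , n₂₄ , n₂₅ , tt)
        , (e₃₄ , n₃₅ , tt) , (e₄₅ , tt) , tt , tt))

    module Glue {f g m n} (F : Induced f m) (H : Induced g n)
      (disjoint : ∀ {i j} → i ≤ m → j ≤ n → f i ≢ g j)
      (first-edge : f 0 ~ g 0) (last-edge : f m ~ g n)
      (cross : ∀ {i j} → i ≤ m → j ≤ n → f i ~ g j → (i ≡ 0 × j ≡ 0) ⊎ (i ≡ m × j ≡ n))
      where

      g′ : ℕ → Vertex
      g′ i = g (n ∸ i)

      g′-last : g′ n ≡ g 0
      g′-last = cong g (n∸n≡0 n)

      cross′ : ∀ {i j} → i ≤ m → j ≤ n → f i ~ g′ j → (i ≡ m × j ≡ 0) ⊎ (i ≡ 0 × j ≡ n)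
      cross′ {j = j} i≤m j≤n e with cross i≤m (m∸n≤m n j) e
      ... | inj₁ (i≡0 , n∸j≡0) = inj₂ (i≡0 , ≤-antisym j≤n (m∸n≡0⇒m≤n n∸j≡0))
      ... | inj₂ (i≡m , n∸j≡n) = inj₁ (i≡m ,
        trans (sym (m∸[m∸n]≡n j≤n)) (trans (cong (n ∸_) n∸j≡n) (n∸n≡0 n)))

      open Join F (reverse H) (λ {_} {j} i≤m _ → disjoint {j = n ∸ j} i≤m (m∸n≤m n j)) last-edge
        (subst (f 0 ~_) (sym g′-last) first-edge) cross′ public

    glue-short : ∀ {f g m n} → Induced f m → Induced g n →
      (∀ {i j} → i ≤ m → j ≤ n → f i ≢ g j) → f 0 ~ g 0 → f m ~ g n →
      (∀ {i j} → i ≤ m → j ≤ n → f i ~ g j → (i ≡ 0 × j ≡ 0) ⊎ (i ≡ m × j ≡ n)) →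
      m + n ≤ 2
    glue-short F H disjoint e₀ e₁ cross with short (Glue.joined-cycle F H disjoint e₀ e₁ cross)
    ... | s≤s (s≤s m+n≤2) = m+n≤2

    -- A square w₀ (c 0) (c m) w₁ sharing only the edge (c 0)(c m) with an induced cycle: a house
    -- when the cycle is a triangle, a domino when it is a square.
    cycle-ladder : ∀ {c m w₀ w₁} → InducedCycle c m → 2 ≤ m →
      w₀ ~ w₁ → w₀ ~ c 0 → w₁ ~ c m →
      (∀ {k} → 0 < k → k ≤ m → ¬ w₀ ~ c k) → (∀ {k} → k < m → ¬ w₁ ~ c k) → ⊥
    cycle-ladder {m = 1} C (s≤s ()) _ _ _ _ _
    cycle-ladder {m = 2} C _ e e₀ e₁ n₀ n₁ =
      no-house (~-sym e) e₀ closing (~-sym e₁) (n₁ z<s) (n₀ z<s ≤-refl)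
        (~-sym (side-edge z<s)) (side-edge (s<s z<s))
        (n₁ (s<s z<s) ∘ ~-sym) (n₀ z<s (s≤s z≤n) ∘ ~-sym)
      where open InducedCycle C using (closing; chords) renaming (edge to side-edge)
    cycle-ladder {m = 3} C _ e e₀ e₁ n₀ n₁ =
      no-domino e₀ (side-edge z<s) (side-edge (s<s z<s)) (side-edge (s<s (s<s z<s)))
        (~-sym e₁) (~-sym e) closing
        (n₀ z<s (s≤s z≤n)) (n₀ z<s (s≤s (s≤s z≤n))) (n₀ z<s ≤-refl)
        (λ c₀~c₂ → case chords {0} {2} z<s (s≤s (s≤s z≤n)) c₀~c₂ of
          λ { (inj₁ ()) ; (inj₂ (_ , ())) })
        (n₁ z<s ∘ ~-sym)
        (λ c₁~c₃ → case chords {1} {3} (s<s z<s) ≤-refl c₁~c₃ of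
          λ { (inj₁ ()) ; (inj₂ (() , _)) })
        (n₁ (s<s z<s) ∘ ~-sym) (n₁ (s<s (s<s z<s)) ∘ ~-sym)
      where open InducedCycle C using (closing; chords) renaming (edge to side-edge)
    cycle-ladder {m = suc (suc (suc (suc m)))} C _ _ _ _ _ _ =
      contradiction (short C) λ { (s≤s (s≤s (s≤s (s≤s ())))) }

    ladder : ∀ {f g m n w₀ w₁} → Induced f m → Induced g n → 1 ≤ m + n →
      (∀ {i j} → i ≤ m → j ≤ n → f i ≢ g j) → f 0 ~ g 0 → f m ~ g n →
      (∀ {i j} → i ≤ m → j ≤ n → f i ~ g j → (i ≡ 0 × j ≡ 0) ⊎ (i ≡ m × j ≡ n)) →
      w₀ ~ w₁ → w₀ ~ f 0 → w₁ ~ g 0 →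
      (∀ {i} → 0 < i → i ≤ m → ¬ w₀ ~ f i) → (∀ {j} → j ≤ n → ¬ w₀ ~ g j) →
      (∀ {i} → i ≤ m → ¬ w₁ ~ f i) → (∀ {j} → 0 < j → j ≤ n → ¬ w₁ ~ g j) → ⊥
    ladder {f} {g} {m} {n} {w₀} {w₁} F H 1≤m+n disjoint e₀ e₁ cross w₀~w₁ w₀~f₀ w₁~g₀
      w₀≁f w₀≁g w₁≁f w₁≁g =
      cycle-ladder joined-cycle (s≤s 1≤m+n) w₀~w₁ w₀~f₀
        (subst (w₁ ~_) (sym (trans (c-right n) g′-last)) w₁~g₀) w₀≁c w₁≁c
      where
      open Glue F H disjoint e₀ e₁ cross
      w₀≁c : ∀ {k} → 0 < k → k ≤ suc (m + n) → ¬ w₀ ~ c k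
      w₀≁c 0<k k≤ e with side m n k≤
      ... | left k≤m      = w₀≁f 0<k k≤m (subst (w₀ ~_) (c-left k≤m) e)
      ... | right {l} l≤n = w₀≁g (m∸n≤m n l) (subst (w₀ ~_) (c-right l) e)
      w₁≁c : ∀ {k} → k < suc (m + n) → ¬ w₁ ~ c k
      w₁≁c k< e with side m n (<⇒≤ k<)
      ... | left k≤m      = w₁≁f k≤m (subst (w₁ ~_) (c-left k≤m) e)
      ... | right {l} l≤n = w₁≁g (m<n⇒0<n∸m (+-cancelˡ-< (suc m) l n k<)) (m∸n≤m n l)
        (subst (w₁ ~_) (c-right l) e)

    -- The square is a x (g 0) (f 0); f runs along P and g along Q, both towards v.
    module Square {f g m n a x} (F : Induced f m) (H : Induced g n) (0<n : 0 < n)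
      (a~x : a ~ x) (x~b : x ~ g 0) (a~f₀ : a ~ f 0) (f₀~b : f 0 ~ g 0) (ends : f m ~ g n)
      (a≁g : ∀ {j} → j ≤ n → ¬ a ~ g j) (x≁g : ∀ {j} → 0 < j → j ≤ n → ¬ x ~ g j)
      (x≁f : ∀ {i} → i ≤ m → ¬ x ~ f i)
      (¬both : ∀ {i} → 0 < i → i ≤ m → ¬ (a ~ f i × f i ~ g 0))
      where

      f₀≢g : ∀ {j} → j ≤ n → f 0 ≢ g j
      f₀≢g j≤n eq = a≁g j≤n (subst (a ~_) eq a~f₀)

      f₀≁g : ∀ {j} → 0 < j → j ≤ n → ¬ f 0 ~ g j
      f₀≁g {suc j} _ j<n e with first (λ k → adj? (f 0) (g (suc k))) {j} e
      ... | k , k≤j , f₀~gₖ , min =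
        ladder (take z≤n F) (take k<n H) (s≤s z≤n)
          (λ { z≤n l≤k → f₀≢g (≤-trans l≤k k<n) })
          f₀~b f₀~gₖ cross a~x a~f₀ x~b (λ { (s≤s _) () })
          (λ l≤k → a≁g (≤-trans l≤k k<n)) (λ { z≤n → x≁f z≤n })
          (λ 0<l l≤k → x≁g 0<l (≤-trans l≤k k<n))
        where
        k<n : k < n
        k<n = ≤-<-trans k≤j j<n
        cross : ∀ {i l} → i ≤ 0 → l ≤ suc k → f i ~ g l →
          (i ≡ 0 × l ≡ 0) ⊎ (i ≡ 0 × l ≡ suc k)
        cross {l = zero}  z≤n _ _ = inj₁ (refl , refl)
        cross {l = suc l} z≤n (s≤s l≤k) e with m≤n⇒m<n∨m≡n l≤k
        ... | inj₁ l<k = contradiction e (min l<k)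
        ... | inj₂ l≡k = inj₂ (refl , cong suc l≡k)

      Meets : ℕ → Set
      Meets k = 0 < k × (a ~ f k ⊎ ∃[ j ] (j ≤ n × f k ~ g j))

      meets? : ∀ k → Dec (Meets k)
      meets? k = (0 <? k) ×-dec (adj? a (f k) ⊎-dec some≤? (λ j → adj? (f k) (g j)) n)

      0<m : 0 < m
      0<m = n≢0⇒n>0 λ m≡0 → f₀≁g 0<n ≤-refl (subst (λ k → f k ~ g n) m≡0 ends)

      module _ {k} (0<k : 0 < k) (k≤m : k ≤ m) (min : ∀ {i} → i < k → ¬ Meets i) where

        meets-a : a ~ f k → ⊥
        meets-a a~fₖ =
          ladder (take k≤m F) (singleton a) (≤-trans 0<k (m≤m+n k 0))
            (λ i≤k _ eq → x≁f (≤-trans i≤k k≤m) (subst (x ~_) (sym eq) (~-sym a~x)))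
            (~-sym a~f₀) (~-sym a~fₖ) cross (~-sym x~b) (~-sym f₀~b) (~-sym a~x)
            b≁f (λ _ → a≁g z≤n ∘ ~-sym) (λ i≤k → x≁f (≤-trans i≤k k≤m))
            (λ { (s≤s _) () })
          where
          cross : ∀ {i j} → i ≤ k → j ≤ 0 → f i ~ a → (i ≡ 0 × j ≡ 0) ⊎ (i ≡ k × j ≡ 0)
          cross {zero}  _ z≤n _ = inj₁ (refl , refl)
          cross {suc i} i≤k z≤n e with m≤n⇒m<n∨m≡n i≤k
          ... | inj₁ i<k = contradiction (z<s , inj₁ (~-sym e)) (min i<k)
          ... | inj₂ i≡k = inj₂ (i≡k , refl)
          b≁f : ∀ {i} → 0 < i → i ≤ k → ¬ g 0 ~ f i
          b≁f 0<i i≤k e with m≤n⇒m<n∨m≡n i≤k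
          ... | inj₁ i<k = min i<k (0<i , inj₂ (0 , z≤n , ~-sym e))
          ... | inj₂ refl = ¬both 0<i k≤m (a~fₖ , ~-sym e)

        meets-g : ¬ a ~ f k → ∀ {j} → j ≤ n → f k ~ g j →
          (∀ {l} → l < j → ¬ f k ~ g l) → ⊥
        meets-g a≁fₖ {j} j≤n fₖ~gⱼ least =
          ladder (take k≤m F) (take j≤n H) (≤-trans 0<k (m≤m+n k j))
            (λ i≤k l≤j → disjoint i≤k (≤-trans l≤j j≤n))
            f₀~b fₖ~gⱼ cross a~x a~f₀ x~b a≁f
            (λ l≤j → a≁g (≤-trans l≤j j≤n)) (λ i≤k → x≁f (≤-trans i≤k k≤m))
            (λ 0<l l≤j → x≁g 0<l (≤-trans l≤j j≤n))
          where
          disjoint : ∀ {i l} → i ≤ k → l ≤ n → f i ≢ g l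
          disjoint {zero}        _   l≤n eq = f₀≢g l≤n eq
          disjoint {suc zero} {zero} i≤k l≤n eq =
            x≁f (≤-trans i≤k k≤m) (subst (x ~_) (sym eq) x~b)
          disjoint {suc zero} {suc l} i≤k l≤n eq =
            f₀≁g z<s l≤n (subst (f 0 ~_) eq (F .edge (≤-trans i≤k k≤m)))
          disjoint {suc (suc i)} {l} i≤k l≤n eq = min i≤k
            (z<s , inj₂ (l , l≤n , subst (f (suc i) ~_) eq (F .edge (≤-trans i≤k k≤m))))
          cross : ∀ {i l} → i ≤ k → l ≤ j → f i ~ g l → (i ≡ 0 × l ≡ 0) ⊎ (i ≡ k × l ≡ j)
          cross {zero} {zero}  _ _ _ = inj₁ (refl , refl)
          cross {zero} {suc l} _ l≤j e = contradiction e (f₀≁g z<s (≤-trans l≤j j≤n))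
          cross {suc i} {l} i≤k l≤j e with m≤n⇒m<n∨m≡n i≤k | m≤n⇒m<n∨m≡n l≤j
          ... | inj₁ i<k  | _        =
            contradiction (z<s , inj₂ (l , ≤-trans l≤j j≤n , e)) (min i<k)
          ... | inj₂ refl | inj₁ l<j = contradiction e (least l<j)
          ... | inj₂ i≡k  | inj₂ l≡j = inj₂ (i≡k , l≡j)
          a≁f : ∀ {i} → 0 < i → i ≤ k → ¬ a ~ f i
          a≁f 0<i i≤k e with m≤n⇒m<n∨m≡n i≤k
          ... | inj₁ i<k  = min i<k (0<i , inj₁ e)
          ... | inj₂ refl = a≁fₖ e

      absurd : ⊥
      absurd with first meets? {m} (0<m , inj₂ (n , ≤-refl , ends))
      ... | k , k≤m , (0<k , inj₁ a~fₖ) , min = meets-a 0<k k≤m min a~fₖ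
      ... | k , k≤m , (0<k , inj₂ (j , j≤n , fₖ~gⱼ)) , min with adj? a (f k)
      ...   | yes a~fₖ = meets-a 0<k k≤m min a~fₖ
      ...   | no a≁fₖ with first (λ l → adj? (f k) (g l)) fₖ~gⱼ
      ...     | l , l≤j , fₖ~gₗ , least =
        meets-g 0<k k≤m min a≁fₖ (≤-trans l≤j j≤n) fₖ~gₗ least

    no-right-turn : ∀ {q n s e h l} → Induced q n → Induced s e →
      2 + h < n → l ≤ e → s e ~ q n → s l ~ q h → s l ~ q (2 + h) →
      (∀ {k} → k ≤ e → ¬ q (1 + h) ~ s k) → ⊥
    no-right-turn {q} {n} {s} {e} {h} {l} Q S 2+h<n l≤e ends sₗ~a sₗ~b x≁s
      with last (λ k → adj? (q h) (s k) ×-dec adj? (s k) (q (2 + h))) l≤e (~-sym sₗ~a , sₗ~b)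
    ... | j , j≤e , (a~sⱼ , sⱼ~b) , max =
      Square.absurd (dropTo j≤e S) (dropTo 2+h≤n Q) (m<n⇒0<n∸m 2+h<n)
        (Q .edge (<-trans (n<1+n h) 1+h<n)) (Q .edge 1+h<n) a~sⱼ sⱼ~b
        (subst₂ (λ k l → s k ~ q l) (sym (m∸n+n≡m j≤e)) (sym (m∸n+n≡m 2+h≤n)) ends)
        (λ {k} k≤ a~ → contradiction
          (Q .chordless (<-≤-trans (n<1+n h) (≤-trans (n≤1+n _) (m≤n+m (2 + h) k)))
            (m≤o∸n⇒m+n≤o k 2+h≤n k≤) a~)
          (>⇒≢ (m≤n+m (2 + h) k)))
        (λ {k} 0<k k≤ x~ → contradiction
          (Q .chordless (m≤n+m (2 + h) k) (m≤o∸n⇒m+n≤o k 2+h≤n k≤) x~)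
          (>⇒≢ (m<n+m (2 + h) 0<k)))
        (λ {k} k≤ → x≁s (m≤o∸n⇒m+n≤o k j≤e k≤))
        (λ {k} 0<k k≤ → max (m<n+m j 0<k) (m≤o∸n⇒m+n≤o k j≤e k≤))
      where
      2+h≤n : 2 + h ≤ n
      2+h≤n = <⇒≤ 2+h<n
      1+h<n : 1 + h < n
      1+h<n = 2+h≤n

    bridge : ∀ {f m s e α β} → Induced f m → Induced s e → 2 ≤ m →
      (∀ {i k} → i ≤ m → k ≤ e → f i ≢ s k) →
      (∀ {i k} → 0 < i → i < m → k ≤ e → ¬ f i ~ s k) →
      α ≤ β → β ≤ e → f 0 ~ s α → f m ~ s β →
      m ≡ 2 × ∃[ l ] (l ≤ e × s l ~ f 0 × s l ~ f m)
    bridge {f} {m} {s} {e} {α} {β} F S 2≤m disjoint interior α≤β β≤e f₀~sα fₘ~sβ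
      with first (λ k → (α ≤? k) ×-dec adj? (f m) (s k)) (α≤β , fₘ~sβ)
    ... | k , k≤β , (α≤k , fₘ~sₖ) , min with last (λ i → adj? (f 0) (s i)) α≤k f₀~sα
    ...   | i , i≤k , f₀~sᵢ , max = m≡2 , i , ≤-trans i≤k k≤e , ~-sym f₀~sᵢ ,
      ~-sym (subst (λ j → f m ~ s j) (≤-antisym (m∸n≡0⇒m≤n n≡0) i≤k) fₘ~sₖ)
      where
      k≤e : k ≤ e
      k≤e = ≤-trans k≤β β≤e
      bound : ∀ {y} → y ≤ k ∸ i → y + i ≤ k
      bound {y} = m≤o∸n⇒m+n≤o y i≤k
      α≤i : α ≤ i
      α≤i = ≮⇒≥ λ i<α → max i<α α≤k f₀~sα
      cross : ∀ {x y} → x ≤ m → y ≤ k ∸ i → f x ~ s (y + i) →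
        (x ≡ 0 × y ≡ 0) ⊎ (x ≡ m × y ≡ k ∸ i)
      cross {zero} {zero}  _ _  _ = inj₁ (refl , refl)
      cross {zero} {suc y} _ y≤ f₀~s = contradiction f₀~s (max (m<n+m i z<s) (bound y≤))
      cross {suc x} {y} x≤m y≤ fₓ~s with m≤n⇒m<n∨m≡n x≤m | m≤n⇒m<n∨m≡n y≤
      ... | inj₁ x<m  | _ = contradiction fₓ~s (interior z<s x<m (≤-trans (bound y≤) k≤e))
      ... | inj₂ refl | inj₁ y<  =
        contradiction (≤-trans α≤i (m≤n+m i y) , fₓ~s) (min (bound y<))
      ... | inj₂ x≡m  | inj₂ y≡  = inj₂ (x≡m , y≡)
      m+n≤2 : m + (k ∸ i) ≤ 2
      m+n≤2 = glue-short F (dropTo i≤k (take k≤e S))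
        (λ x≤m y≤ → disjoint x≤m (≤-trans (bound y≤) k≤e)) f₀~sᵢ
        (subst (λ j → f m ~ s j) (sym (m∸n+n≡m i≤k)) fₘ~sₖ) cross
      m≡2 : m ≡ 2
      m≡2 = ≤-antisym (≤-trans (m≤m+n m (k ∸ i)) m+n≤2) 2≤m
      n≡0 : k ∸ i ≡ 0
      n≡0 = n≤0⇒n≡0 (+-cancelˡ-≤ 2 (k ∸ i) 0 (subst (λ j → j + (k ∸ i) ≤ 2) m≡2 m+n≤2))

    dominated : ∀ {q n s e i} → Induced q n → Induced s e → 3 ≤ n →
      q 0 ~ s 0 → q n ~ s e → i ≤ n →
      (∀ {k} → k ≤ e → ¬ q i ~ s k) → (∀ {k} → k ≤ e → q i ≢ s k) → ⊥
    dominated {q} {n} {s} {e} {i} Q S 3≤n q₀~s₀ qₙ~sₑ i≤n x≁s x≢s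
      with last {P = λ j → ∃[ k ] (k ≤ e × q j ~ s k)}
             (λ j → some≤? (λ k → adj? (q j) (s k)) e) {0} {i} z≤n (0 , z≤n , q₀~s₀)
         | first {P = λ j → i ≤ j × ∃[ k ] (k ≤ e × q j ~ s k)}
             (λ j → (i ≤? j) ×-dec some≤? (λ k → adj? (q j) (s k)) e) {n} (i≤n , e , ≤-refl , qₙ~sₑ)
    ... | h , h≤i , (α , α≤e , qₕ~sα) , max | t , t≤n , (i≤t , β , β≤e , qₜ~sβ) , min = conclude turn
      where
      h<i : h < i
      h<i = ≤∧≢⇒< h≤i λ { refl → x≁s α≤e qₕ~sα }
      i<t : i < t
      i<t = ≤∧≢⇒< i≤t λ { refl → x≁s β≤e qₜ~sβ }
      h≤t : h ≤ t
      h≤t = ≤-trans h≤i i≤t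
      between : ∀ {j k} → h < j → j < t → k ≤ e → ¬ q j ~ s k
      between {j} {k} h<j j<t k≤e qⱼ~sₖ with ≤-total j i
      ... | inj₁ j≤i = max h<j j≤i (k , k≤e , qⱼ~sₖ)
      ... | inj₂ i≤j = min j<t (i≤j , k , k≤e , qⱼ~sₖ)
      disjoint : ∀ {j k} → h ≤ j → j ≤ t → k ≤ e → q j ≢ s k
      disjoint {j} h≤j j≤t k≤e eq with <-cmp j i
      ... | tri< j<i _ _ = between (s≤s h≤j) (≤-<-trans j<i i<t) k≤e
        (subst (q (suc j) ~_) eq (~-sym (Q .edge (<-≤-trans j<i i≤n))))
      ... | tri≈ _ refl _ = x≢s k≤e eq
      disjoint {suc j} h≤j j≤t k≤e eq | tri> _ _ (s≤s i≤j) = between (<-≤-trans h<i i≤j) j≤t k≤e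
        (subst (q j ~_) eq (Q .edge (≤-trans j≤t t≤n)))
      f : ℕ → Vertex
      f j = q (j + h)
      m : ℕ
      m = t ∸ h
      F : Induced f m
      F = dropTo h≤t (take t≤n Q)
      fₘ≡ : f m ≡ q t
      fₘ≡ = cong q (m∸n+n≡m h≤t)
      2≤m : 2 ≤ m
      2≤m = m+n≤o⇒m≤o∸n 2 (≤-trans (s≤s h<i) i<t)
      f-disjoint : ∀ {j k} → j ≤ m → k ≤ e → f j ≢ s k
      f-disjoint {j} j≤m = disjoint (m≤n+m h j) (m≤o∸n⇒m+n≤o j h≤t j≤m)
      f-interior : ∀ {j k} → 0 < j → j < m → k ≤ e → ¬ f j ~ s k
      f-interior {j} 0<j j<m = between (m<n+m h 0<j) (m≤o∸n⇒m+n≤o (suc j) h≤t j<m)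
      turn : m ≡ 2 × ∃[ l ] (l ≤ e × s l ~ f 0 × s l ~ f m)
      turn with ≤-total α β
      ... | inj₁ α≤β = bridge F S 2≤m f-disjoint f-interior α≤β β≤e qₕ~sα
        (subst (_~ s β) (sym fₘ≡) qₜ~sβ)
      ... | inj₂ β≤α with bridge (reverse F) S 2≤m
          (λ {j} _ → f-disjoint (m∸n≤m m j))
          (λ {j} 0<j j<m → f-interior (m<n⇒0<n∸m j<m)
            (∸-monoʳ-< 0<j (<⇒≤ j<m)))
          β≤α α≤e (subst (_~ s β) (sym fₘ≡) qₜ~sβ)
          (subst (λ j → f j ~ s α) (sym (n∸n≡0 m)) qₕ~sα)
      ...   | m≡2 , l , l≤e , sₗ~fₘ , sₗ~f₀ =
        m≡2 , l , l≤e , subst (λ j → s l ~ f j) (n∸n≡0 m) sₗ~f₀ , sₗ~fₘ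
      conclude : m ≡ 2 × ∃[ l ] (l ≤ e × s l ~ f 0 × s l ~ f m) → ⊥
      conclude (m≡2 , l , l≤e , sₗ~a , sₗ~fₘ) with m≤n⇒m<n∨m≡n (subst (_≤ n) t≡2+h t≤n)
        where
        t≡2+h : t ≡ 2 + h
        t≡2+h = trans (sym (m∸n+n≡m h≤t)) (cong (_+ h) m≡2)
      ... | inj₁ 2+h<n = no-right-turn Q S 2+h<n l≤e (~-sym qₙ~sₑ) sₗ~a
        (subst (λ j → s l ~ f j) m≡2 sₗ~fₘ) x≁s′
        where
        x≁s′ : ∀ {k} → k ≤ e → ¬ q (1 + h) ~ s k
        x≁s′ = f-interior z<s (subst (1 <_) (sym m≡2) ≤-refl)
      ... | inj₂ refl = no-right-turn {h = 0} {l = e ∸ l} (reverse Q) (reverse S) 3≤n (m∸n≤m e l)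
        (subst₂ (λ j k → s j ~ q k) (sym (n∸n≡0 e)) (sym (n∸n≡0 h)) (~-sym q₀~s₀))
        (subst (λ j → s j ~ q (2 + h)) (sym (m∸[m∸n]≡n l≤e)) (subst (λ j → s l ~ f j) m≡2 sₗ~fₘ))
        (subst (λ j → s j ~ q h) (sym (m∸[m∸n]≡n l≤e)) sₗ~a)
        (λ {k} _ → f-interior z<s (subst (1 <_) (sym m≡2) ≤-refl) (m∸n≤m e k))

    induced-dominates : ∀ {p q m n i} → Induced p m → Induced q n → 3 ≤ n →
      p 0 ≡ q 0 → p m ≡ q n → ¬ p 0 ~ p m → i ≤ n →
      ∃[ k ] (0 < k × k < m × q i ~ p k) ⊎ ∃[ k ] (k ≤ m × q i ≡ p k)
    induced-dominates {m = 0} _ Q 3≤n eq₀ eq₁ _ _ =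
      contradiction (trans (sym eq₀) eq₁) (Q .distinct (<-≤-trans z<s 3≤n) ≤-refl)
    induced-dominates {m = 1} P _ _ _ _ u≁v _ = contradiction (P .edge z<s) u≁v
    induced-dominates {p} {q} {suc (suc e)} {n} {i} P Q 3≤n eq₀ eq₁ _ i≤n
      with some≤? (λ k → adj? (q i) (p (suc k))) e
         | some≤? (λ k → q i Fin.≟ p k) (suc (suc e))
    ... | yes (k , k≤e , e) | _      = inj₁ (suc k , z<s , s<s (s≤s k≤e) , e)
    ... | no  _             | yes x∈ = inj₂ x∈
    ... | no  x≁            | no x∉  = ⊥-elim (dominated Q (take (n≤1+n e) (tail P)) 3≤n
      (subst (_~ p 1) eq₀ (P .edge z<s))
      (subst (_~ p (suc e)) eq₁ (~-sym (P .edge ≤-refl))) i≤n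
      (λ {k} k≤e e → x≁ (k , k≤e , e))
      (λ {k} k≤e eq → x∉ (suc k , s≤s (m≤n⇒m≤1+n k≤e) , eq)))

  -- Positions beyond the end are clamped to the last vertex.
  at : ∀ {n} → (Fin (suc n) → Vertex) → ℕ → Vertex
  at {n} w k = w (fromℕ< (s≤s (m⊓n≤n k n)))

  at-toℕ : ∀ {n} (w : Fin (suc n) → Vertex) i → at w (toℕ i) ≡ w i
  at-toℕ w i = cong w (Fin.toℕ-injective
    (trans (Fin.toℕ-fromℕ< _) (m≤n⇒m⊓n≡m (Fin.toℕ≤pred[n] i))))

  position : ∀ {n k} (w : Fin (suc n) → Vertex) → k ≤ n → ∃[ i ] (toℕ i ≡ k × w i ≡ at w k)
  position w k≤n = i , toℕi≡k , trans (sym (at-toℕ w i)) (cong (at w) toℕi≡k)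
    where
    i = fromℕ< (s≤s k≤n)
    toℕi≡k = Fin.toℕ-fromℕ< (s≤s k≤n)

  module _ {u v : Vertex} (W : Walk G u v) where
    open Walk W

    at-start : at vertex 0 ≡ u
    at-start = trans (at-toℕ vertex zero) start

    at-end : at vertex length ≡ v
    at-end = trans (cong (at vertex) (sym (Fin.toℕ-fromℕ length)))
      (trans (at-toℕ vertex (fromℕ length)) end)

    at-step : ∀ {k} → k < length → at vertex k ~ at vertex (suc k)
    at-step k<n = subst (λ k → at vertex k ~ at vertex (suc k)) (Fin.toℕ-fromℕ< k<n)
      (subst₂ _~_
        (trans (sym (at-toℕ vertex (inject₁ i))) (cong (at vertex) (Fin.toℕ-inject₁ i)))
        (sym (at-toℕ vertex (suc i))) (step i))
      where i = fromℕ< k<n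

    toInduced : IsInducedPath W → Induced (at vertex) length
    toInduced _ .edge = at-step
    toInduced (inj , _) .distinct i<j j≤n eq
      with position vertex (≤-trans (<⇒≤ i<j) j≤n) | position vertex j≤n
    ... | i , refl , wi | j , refl , wj =
      <⇒≢ i<j (cong toℕ (inj (trans wi (trans eq (sym wj)))))
    toInduced (_ , adj) .chordless i<j j≤n e
      with position vertex (≤-trans (<⇒≤ i<j) j≤n) | position vertex j≤n
    ... | i , refl , wi | j , refl , wj
      with Equivalence.to (adj i j) (subst₂ _~_ (sym wi) (sym wj) e)
    ...   | inj₁ j≡1+i = j≡1+i
    ...   | inj₂ i≡1+j = contradiction (<-trans i<j (≤-reflexive (sym i≡1+j))) (<-irrefl refl)

    isInducedPath : IsPath W →
      (∀ {i j} → i Fin.< j → vertex i ~ vertex j → toℕ j ≡ suc (toℕ i)) → IsInducedPath W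
    isInducedPath inj chord = inj , λ i j → mk⇔ (to i j) (from i j)
      where
      to : ∀ i j → vertex i ~ vertex j → Consecutive i j
      to i j e with Fin.<-cmp i j
      ... | tri< i<j _ _  = inj₁ (chord i<j e)
      ... | tri≈ _ refl _ = contradiction e (irrefl refl)
      ... | tri> _ _ j<i  = inj₂ (chord j<i (~-sym e))
      next : ∀ i j → toℕ j ≡ suc (toℕ i) → vertex i ~ vertex j
      next i j eq = subst₂ _~_ (at-toℕ vertex i)
        (trans (cong (at vertex) (sym eq)) (at-toℕ vertex j))
        (at-step (subst (_≤ length) eq (Fin.toℕ≤pred[n] j)))
      from : ∀ i j → Consecutive i j → vertex i ~ vertex j
      from i j (inj₁ eq) = next i j eq
      from i j (inj₂ eq) = ~-sym (next j i eq)

  hhdFree⇒dominates : HHDFree G → ∀ {u v} → ¬ u ~ v → (W W′ : Walk G u v) →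
    IsInducedPath W → m₃ G W′ → W Dominates W′
  hhdFree⇒dominates hhd u≁v W W′ ind (ind′ , 3≤n) _ (i , _ , _ , refl)
    with induced-dominates hhd (toInduced W ind) (toInduced W′ ind′) 3≤n
      (trans (at-start W) (sym (at-start W′))) (trans (at-end W) (sym (at-end W′)))
      (u≁v ∘ subst₂ _~_ (at-start W) (at-end W)) (Fin.toℕ≤pred[n] i)
  ... | inj₁ (k , 0<k , k<n , e) with position (Walk.vertex W) (<⇒≤ k<n)
  ...   | j , refl , wj = inj₁ (Walk.vertex W j , (j , 0<k , k<n , refl) ,
    subst₂ _~_ (at-toℕ (Walk.vertex W′) i) (sym wj) e)
  hhdFree⇒dominates hhd u≁v W W′ ind (ind′ , 3≤n) _ (i , _ , _ , refl)
    | inj₂ (k , k≤n , eq) with position (Walk.vertex W) k≤n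
  ...   | j , refl , wj = inj₂ (j , trans wj (trans (sym eq) (at-toℕ (Walk.vertex W′) i)))

  Reaches : Vertex → Vertex → ℕ → Set
  Reaches u v k = ∃[ W ] Walk.length {G} {u} {v} W ≡ k

  here : ∀ {u} → Reaches u u 0
  here {u} =
    record { length = 0 ; vertex = const u ; start = refl ; end = refl ; step = λ () } , refl

  extend : ∀ {u w v k} → u ~ w → Reaches w v k → Reaches u v (suc k)
  extend {u} u~w (W , refl) = record
    { length = suc (W .Walk.length)
    ; vertex = λ { zero → u ; (suc i) → Walk.vertex W i }
    ; start  = refl
    ; end    = Walk.end W
    ; step   = λ { zero → subst (u ~_) (sym (Walk.start W)) u~w ; (suc i) → Walk.step W i }
    } , refl

  prepend : ∀ (p : ℕ → Vertex) {v k} i → (∀ {j} → j < i → p j ~ p (suc j)) →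
    Reaches (p i) v k → Reaches (p 0) v (i + k)
  prepend p zero    steps r = r
  prepend p (suc i) steps r = extend (steps z<s) (prepend (p ∘ suc) i (steps ∘ s<s) r)

  shortest⇒induced : ∀ {u v} (W : Walk G u v) → SP G W → IsInducedPath W
  shortest⇒induced {u} {v} W (inj , _ , minimal) = isInducedPath W inj λ {i} {j} i<j e →
    ≤-antisym (≮⇒≥ λ 1+i<j → shortcut i j 1+i<j e) i<j
    where
    open Walk W
    shortcut : ∀ i j → suc (toℕ i) < toℕ j → ¬ vertex i ~ vertex j
    shortcut i j 1+i<j e = contradiction (minimal W′) (<⇒≱ (subst (_< length) (sym length≡) shorter))
      where
      p = at vertex
      j≤ : toℕ j ≤ length
      j≤ = Fin.toℕ≤pred[n] j
      bypass : Reaches u v (toℕ i + suc (length ∸ toℕ j + 0))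
      bypass = subst (λ x → Reaches x v _) (at-start W)
        (prepend p (toℕ i) (λ k<i → at-step W (<-≤-trans k<i (Fin.toℕ≤pred[n] i)))
          (extend (subst₂ _~_ (sym (at-toℕ vertex i)) (sym (at-toℕ vertex j)) e)
            (prepend (λ k → p (k + toℕ j)) (length ∸ toℕ j)
              (λ {k} k< → at-step W (m≤o∸n⇒m+n≤o (suc k) j≤ k<))
              (subst (λ x → Reaches x v 0)
                (sym (trans (cong p (m∸n+n≡m j≤)) (at-end W))) here))))
      W′ = proj₁ bypass
      length≡ = proj₂ bypass
      shorter : toℕ i + suc (length ∸ toℕ j + 0) < length
      shorter = begin-strict
        toℕ i + suc (length ∸ toℕ j + 0)  ≡⟨ cong (λ k → toℕ i + suc k) (+-identityʳ _) ⟩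
        toℕ i + suc (length ∸ toℕ j)      ≡⟨ +-suc (toℕ i) _ ⟩
        suc (toℕ i) + (length ∸ toℕ j)    <⟨ +-monoˡ-< (length ∸ toℕ j) 1+i<j ⟩
        toℕ j + (length ∸ toℕ j)          ≡⟨ m+[n∸m]≡n j≤ ⟩
        length                            ∎
        where open ≤-Reasoning

  2≤length : ∀ {u v} → u ≢ v → ¬ u ~ v → (W : Walk G u v) → 2 ≤ Walk.length W
  2≤length u≢v _ record { length = 0 ; start = refl ; end = refl } = contradiction refl u≢v
  2≤length _ u≁v record { length = 1 ; start = refl ; end = refl ; step = step } =
    contradiction (step zero) u≁v
  2≤length _ _ record { length = suc (suc _) } = s≤s (s≤s z≤n)

  l₂⇒shortest : ∀ {u v} → ¬ u ~ v → (W : Walk G u v) → l 2 G W → SP G W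
  l₂⇒shortest {u} {v} u≁v W ((inj , _) , ≤2) = inj , (W , refl) , minimal
    where
    minimal : ∀ W′ → Walk.length W ≤ Walk.length W′
    minimal W′ with u Fin.≟ v
    ... | no u≢v = ≤-trans ≤2 (2≤length u≢v u≁v W′)
    ... | yes refl = subst (_≤ Walk.length W′) (sym (trans (sym (Fin.toℕ-fromℕ _))
      (cong toℕ (inj (trans (Walk.end W) (sym (Walk.start W))))))) z≤n

module _ {H G : Graph} (emb : H InducedIn G) where
  private
    φ = proj₁ emb
    φ-injective = proj₁ (proj₂ emb)
    φ-⇔ = proj₂ (proj₂ emb)

  image : ∀ {u v} → Walk H u v → Walk G (φ u) (φ v)
  image W = record
    { length = length
    ; vertex = φ ∘ vertex
    ; start  = cong φ start
    ; end    = cong φ end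
    ; step   = λ i → Equivalence.to (φ-⇔ _ _) (step i)
    }
    where open Walk W

  image-induced : ∀ {u v} (W : Walk H u v) → IsInducedPath W → IsInducedPath (image W)
  image-induced W (inj , adj) = inj ∘ φ-injective , λ i j →
    mk⇔ (Equivalence.to (adj i j) ∘ Equivalence.from (φ-⇔ _ _))
        (Equivalence.to (φ-⇔ _ _) ∘ Equivalence.from (adj i j))

  image-dominates : ∀ {u v} (W W′ : Walk H u v) → image W Dominates image W′ → W Dominates W′
  image-dominates W W′ dom x (i , 0<i , i<n , eq) with dom (φ x) (i , 0<i , i<n , cong φ eq)
  ... | inj₁ (_ , (j , 0<j , j<m , refl) , e) =
    inj₁ (Walk.vertex W j , (j , 0<j , j<m , refl) , Equivalence.from (φ-⇔ _ _) e)
  ... | inj₂ (j , eq′) = inj₂ (j , φ-injective eq′)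

  hereditary : (l 2 / m₃) G → (l 2 / m₃) H
  hereditary dom u v u≁v W W′ (ind , ≤2) (ind′ , 3≤) = image-dominates W W′
    (dom (φ u) (φ v) (u≁v ∘ Equivalence.from (φ-⇔ u v)) (image W) (image W′)
      (image-induced W ind , ≤2) (image-induced W′ ind′ , 3≤))

module _ (G : Graph) where
  open Graph G

  isInducedPath? : ∀ {u v} (W : Walk G u v) → Dec (IsInducedPath W)
  isInducedPath? W =
    map′ (λ p {i} {j} → p i j) (λ p i j → p {i} {j})
      (Fin.all? λ i → Fin.all? λ j → (vertex i Fin.≟ vertex j) →-dec (i Fin.≟ j))
    ×-dec
    map′ (λ p i j → mk⇔ (proj₁ (p i j)) (proj₂ (p i j)))
         (λ p i j → Equivalence.to (p i j) , Equivalence.from (p i j))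
      (Fin.all? λ i → Fin.all? λ j →
        let a? = adj? (vertex i) (vertex j)
            c? = (toℕ j ≟ suc (toℕ i)) ⊎-dec (toℕ i ≟ suc (toℕ j))
        in (a? →-dec c?) ×-dec (c? →-dec a?))
    where open Walk W

  dominates? : ∀ {u v} (W W′ : Walk G u v) → Dec (W Dominates W′)
  dominates? W W′ = Fin.all? λ x → internal? W′ x →-dec
    (Fin.any? (λ y → internal? W y ×-dec adj? x y) ⊎-dec Fin.any? λ i → Walk.vertex W i Fin.≟ x)
    where
    internal? : ∀ {u v} (W : Walk G u v) x → Dec (x ∈° W)
    internal? W x = Fin.any? λ i →
      (0 <? toℕ i) ×-dec ((toℕ i <? Walk.length W) ×-dec (Walk.vertex W i Fin.≟ x))

  Violation : ∀ {u v} (W W′ : Walk G u v) → Set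
  Violation {u} {v} W W′ = ¬ Adj u v × l 2 G W × m₃ G W′ × ¬ W Dominates W′

  violation? : ∀ {u v} (W W′ : Walk G u v) → Dec (Violation W W′)
  violation? {u} {v} W W′ = ¬? (adj? u v) ×-dec
    ((isInducedPath? W ×-dec (Walk.length W ≤? 2)) ×-dec
    ((isInducedPath? W′ ×-dec (3 ≤? Walk.length W′)) ×-dec ¬? (dominates? W W′)))

  violated : ∀ {u v} (W W′ : Walk G u v) → Violation W W′ → ¬ (l 2 / m₃) G
  violated {u} {v} W W′ (u≁v , w , w′ , ¬dom) dom = ¬dom (dom u v u≁v W W′ w w′)

  Steps : ∀ {n} → Vec Vertex (suc n) → Set
  Steps xs = ∀ i → Adj (lookup xs (inject₁ i)) (lookup xs (suc i))

  steps? : ∀ {n} (xs : Vec Vertex (suc n)) → Dec (Steps xs)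
  steps? xs = Fin.all? λ i → adj? _ _

  route : ∀ {n} (xs : Vec Vertex (suc n)) → Steps xs →
    Walk G (lookup xs zero) (lookup xs (fromℕ n))
  route xs steps = record
    { length = _ ; vertex = lookup xs ; start = refl ; end = refl ; step = steps }

  checkedRoute : ∀ {n} (xs : Vec Vertex (suc n)) {_ : True (steps? xs)} →
    Walk G (lookup xs zero) (lookup xs (fromℕ n))
  checkedRoute xs {steps} = route xs (toWitness steps)

house-violates : ¬ (l 2 / m₃) house
house-violates = violated house W W′ (from-yes (violation? house W W′))
  where
  W = checkedRoute house (# 2 ∷ # 0 ∷ # 3 ∷ [])
  W′ = checkedRoute house (# 2 ∷ # 4 ∷ # 1 ∷ # 3 ∷ [])

domino-violates : ¬ (l 2 / m₃) domino
domino-violates = violated domino W W′ (from-yes (violation? domino W W′))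
  where
  W = checkedRoute domino (# 0 ∷ # 1 ∷ # 2 ∷ [])
  W′ = checkedRoute domino (# 0 ∷ # 5 ∷ # 4 ∷ # 3 ∷ # 2 ∷ [])

module _ (m : ℕ) where
  private
    C = cycle (5 + m)
    end : Graph.Vertex C
    end = fromℕ (4 + m)

  short-arc : Walk C (# 1) end
  short-arc = route C (# 1 ∷ # 0 ∷ end ∷ []) λ where
    zero       → (λ ()) , inj₂ (inj₁ refl)
    (suc zero) → (λ ()) , inj₂ (inj₂ (cong (5 +_) (Fin.toℕ-fromℕ m) , refl))

  long-arc : Walk C (# 1) end
  long-arc = record
    { length = 3 + m
    ; vertex = suc
    ; start  = refl
    ; end    = refl
    ; step   = λ i → Fin.<⇒≢ (s≤s (≤-reflexive (cong suc (Fin.toℕ-inject₁ i)))) ,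
        inj₁ (inj₁ (cong (2 +_) (sym (Fin.toℕ-inject₁ i))))
    }

  1≁end : ¬ Graph.Adj C (# 1) end
  1≁end (_ , inj₁ (inj₁ ()))
  1≁end (_ , inj₁ (inj₂ ()))
  1≁end (_ , inj₂ (inj₁ ()))
  1≁end (_ , inj₂ (inj₂ ()))

  short-arc-induced : IsInducedPath short-arc
  short-arc-induced = isInducedPath C short-arc inj chord
    where
    inj : IsPath short-arc
    inj {zero}           {zero}           _ = refl
    inj {suc zero}       {suc zero}       _ = refl
    inj {suc (suc zero)} {suc (suc zero)} _ = refl
    inj {zero}           {suc zero}       ()
    inj {zero}           {suc (suc zero)} ()
    inj {suc zero}       {suc (suc zero)} ()
    chord : ∀ {i j} → i Fin.< j → _ → toℕ j ≡ suc (toℕ i)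
    chord {zero}     {suc zero}       _ _ = refl
    chord {zero}     {suc (suc zero)} _ e = contradiction e 1≁end
    chord {suc zero} {suc (suc zero)} _ _ = refl
    chord {suc zero} {suc zero} (s≤s ()) _
    chord {suc (suc zero)} {suc zero} (s≤s ()) _
    chord {suc (suc zero)} {suc (suc zero)} (s≤s (s≤s ())) _

  long-arc-induced : IsInducedPath long-arc
  long-arc-induced = isInducedPath C long-arc Fin.suc-injective chord
    where
    chord : ∀ {i j} → i Fin.< j → Graph.Adj C (suc i) (suc j) → toℕ j ≡ suc (toℕ i)
    chord _ (_ , inj₁ (inj₁ 1+j≡2+i)) = suc-injective 1+j≡2+i
    chord _ (_ , inj₁ (inj₂ (_ , ())))
    chord i<j (_ , inj₂ (inj₁ 1+i≡2+j)) =
      contradiction (<-trans i<j (≤-reflexive (sym (suc-injective 1+i≡2+j)))) (<-irrefl refl)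
    chord _ (_ , inj₂ (inj₂ (_ , ())))

  arcs-¬dominate : ¬ short-arc Dominates long-arc
  arcs-¬dominate dom with dom (# 2) (# 1 , s≤s z≤n , s≤s (s≤s z≤n) , refl)
  ... | inj₁ (_ , (suc zero , _ , _ , refl) , _ , inj₁ (inj₁ ()))
  ... | inj₁ (_ , (suc zero , _ , _ , refl) , _ , inj₁ (inj₂ ()))
  ... | inj₁ (_ , (suc zero , _ , _ , refl) , _ , inj₂ (inj₁ ()))
  ... | inj₁ (_ , (suc zero , _ , _ , refl) , _ , inj₂ (inj₂ ()))
  ... | inj₁ (_ , (suc (suc zero) , _ , s≤s (s≤s ()) , _) , _)
  ... | inj₂ (zero , ())
  ... | inj₂ (suc zero , ())
  ... | inj₂ (suc (suc zero) , ())

  hole-violates : ¬ (l 2 / m₃) C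
  hole-violates = violated C short-arc long-arc
    (1≁end , (short-arc-induced , s≤s (s≤s z≤n)) ,
      (long-arc-induced , s≤s (s≤s (s≤s z≤n))) , arcs-¬dominate)

l₂/m₃⇒hhdFree : ∀ {G} → (l 2 / m₃) G → HHDFree G
l₂/m₃⇒hhdFree dom =
  (λ emb → house-violates (hereditary emb dom)) ,
  (λ { _ (s≤s (s≤s (s≤s (s≤s (s≤s {n = m} z≤n))))) emb → hole-violates m (hereditary emb dom) }) ,
  (λ emb → domino-violates (hereditary emb dom))

theorem5 : (G : Graph) → Connected G →
    ((l 2 / m₃) G ⇔ (l 3 / m₃) G) ×
    ((l 3 / m₃) G ⇔ (SP / m₃) G) ×
    ((SP / m₃) G ⇔ HHDFree G)
theorem5 G _ =
    mk⇔ (hhd⇒l₃ ∘ l₂/m₃⇒hhdFree) l₃⇒l₂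
  , mk⇔ (hhd⇒SP ∘ l₂/m₃⇒hhdFree ∘ l₃⇒l₂) (hhd⇒l₃ ∘ l₂/m₃⇒hhdFree ∘ SP⇒l₂)
  , mk⇔ (l₂/m₃⇒hhdFree ∘ SP⇒l₂) hhd⇒SP
  where
  l₃⇒l₂ : (l 3 / m₃) G → (l 2 / m₃) G
  l₃⇒l₂ dom u v u≁v W W′ (ind , ≤2) = dom u v u≁v W W′ (ind , m≤n⇒m≤1+n ≤2)
  SP⇒l₂ : (SP / m₃) G → (l 2 / m₃) G
  SP⇒l₂ dom u v u≁v W W′ W∈l₂ = dom u v u≁v W W′ (l₂⇒shortest G u≁v W W∈l₂)
  hhd⇒l₃ : HHDFree G → (l 3 / m₃) G
  hhd⇒l₃ hhd u v u≁v W W′ (ind , _) = hhdFree⇒dominates G hhd u≁v W W′ ind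
  hhd⇒SP : HHDFree G → (SP / m₃) G
  hhd⇒SP hhd u v u≁v W W′ sp =
    hhdFree⇒dominates G hhd u≁v W W′ (shortest⇒induced G W sp)
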